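{- For every positive integer $n$, let $f$ be chosen uniformly at random from $F(n)$. Then the probability of the event "for every $h\in F(n)$, if $\mathcal{A}(h)$ and $\mathcal{A}(f)$ are isomorphic digraphs then $h\sim f$" tends to $1$ as $n\to\infty$.
   Context: $F(n)$ is the set of all functions $f:\{0,1\}^n\to\{0,1\}^n$ (Boolean networks), written $f=(f_1,\dots,f_n)$. For $i\in[n]$, $e_i$ is the configuration with a $1$ exactly in component $i$, and addition of configurations is componentwise modulo $2$. The asynchronous graph $\mathcal{A}(f)$ is the digraph on $\{0,1\}^n$ with an arc from $x$ to $x+e_i$ for every $x$ and every $i\in[n]$ with $f_i(x)\neq x_i$. The synchronous graph $\mathcal{S}(f)$ is the digraph on $\{0,1\}^n$ with an arc from $x$ to $f(x)$ for every $x$. For $f,h\in F(n)$, $f\sim h$ means $\mathcal{S}(f)$ and $\mathcal{S}(h)$ are isomorphic digraphs (equivalently $h=\pi\circ f\circ\pi^{ -1}$ for some permutation $\pi$ of $\{0,1\}^n$). -}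

module Defs where

open import Data.Nat using (ℕ; _^_)
open import Data.Bool using (Bool; not)
open import Data.Fin using (Fin)
open import Data.Vec using (Vec; lookup; updateAt)
open import Data.Product using (Σ; ∃; _×_)
open import Relation.Binary.PropositionalEquality using (_≡_; _≢_)
open import Relation.Nullary using (¬_)
open import Function.Bundles using (_↔_; Inverse; _⇔_)
open import Level using (0ℓ)

-- Configurations {0,1}^n (Bool for {0,1}); Vec so that ≡ is extensional.
Config : ℕ → Set
Config n = Vec Bool n

BN : ℕ → Set
BN n = Config n → Config n

flipAt : ∀ {n} → Config n → Fin n → Config n
flipAt x i = updateAt x i not

AArc : ∀ {n} → BN n → Config n → Config n → Set
AArc f x y = ∃ λ i → (lookup (f x) i ≢ lookup x i) × (y ≡ flipAt x i)

SArc : ∀ {n} → BN n → Config n → Config n → Set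
SArc f x y = f x ≡ y

DigraphIso : {V : Set} → (V → V → Set) → (V → V → Set) → Set
DigraphIso {V} E E' =
  Σ (V ↔ V) λ π → ∀ x y → E x y ⇔ E' (Inverse.to π x) (Inverse.to π y)

_∼_ : ∀ {n} → BN n → BN n → Set
h ∼ f = DigraphIso (SArc h) (SArc f)

Good : ∀ {n} → BN n → Set
Good {n} f = (h : BN n) → DigraphIso (AArc h) (AArc f) → h ∼ f

cardF : ℕ → ℕ
cardF n = (2 ^ n) ^ (2 ^ n)

{-# OPTIONS --safe #-}
module Submission where

-- Let G be the undirected graph underlying 𝒜(f), a random subgraph of the cube in which each edge is
-- absent with probability 1/4.  The inverse ψ of an isomorphism 𝒜(h) → 𝒜(f) maps edges of G to cube
-- edges.  A cube edge {u, u+eᵢ} is also mapped to a cube edge as soon as four squares on it have their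
-- other three edges mapped to cube edges.  With high probability
--   (1) every vertex u has at least 4w ≈ 3n/32 edges of G;
--   (2) hence at every u fewer than w directions j fail to have four squares
--       u, u+eₖ, u+eₖ+eⱼ, u+eⱼ whose edges other than {u, u+eⱼ} lie in G;
--   (3) for every u and i, at least 4w of the edges {u+eⱼ, u+eⱼ+eᵢ} lie in G.
-- Together these imply that ψ preserves all cube edges, so it is an automorphism of the cube, and
-- then ψ conjugates f to h.  Each failure exhibits z distinct absent edges from a family of far fewer
-- than 4^z sets, so a union bound suffices.

open import Defs
open import Data.Nat using (ℕ; zero; suc; _+_; _*_; _^_; _≤_; _≤?_; _/_; _%_; z≤n)
import Data.Nat.Properties as ℕ
open import Data.Nat.DivMod using (m≡m%n+[m/n]*n; m%n<n; /-monoˡ-≤; m*n/n≡m)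
open import Data.Nat.Tactic.RingSolver using (solve-∀)
open import Data.Bool using (Bool; true; false; not; _xor_; _∨_)
import Data.Bool.Properties as Bool
open import Data.Fin using (Fin; zero; suc; combine; remQuot; inject≤; punchOut)
open import Data.Fin.Properties using (_≟_; any?; all?; ¬∀⟶∃¬; pigeonhole; injective⇒≤; <⇒≢; punchOut-injective; suc-injective; combine-injective; remQuot-combine; combine-remQuot; inject≤-injective)
open import Data.Fin.Subset using (Subset; ∣_∣; ∁)
open import Data.Vec using (Vec; []; _∷_; lookup; tabulate)
open import Data.Vec.Properties using (≡-dec; lookup∘updateAt; lookup∘updateAt′; updateAt-updateAt; updateAt-id; updateAt-cong; updateAt-commutes; tabulate∘lookup; tabulate-cong; lookup∘tabulate; lookup-map)
open import Data.List as List using (List; []; _∷_; length; map; _++_; cartesianProductWith; allFin)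
open import Data.List.Properties using (length-map; length-++; length-tabulate)
open import Data.List.Membership.Propositional using (_∈_)
open import Data.List.Membership.Propositional.Properties using (∈-map⁺; ∈-++⁺ˡ; ∈-++⁺ʳ; ∈-cartesianProductWith⁺; ∈-allFin)
import Data.List.Membership.DecPropositional as DecMembership
open import Data.List.Relation.Unary.Any using (here; there; index)
open import Data.List.Relation.Unary.Any.Properties using (lookup-index)
open import Data.Product using (Σ; ∃; _×_; _,_; proj₁; proj₂; uncurry)
open import Data.Product.Properties using (,-injective)
open import Data.Sum using (_⊎_; inj₁; inj₂; [_,_]′)
open import Function using (_∘_)
open import Function.Bundles using (Inverse; _⇔_; Equivalence; mk⇔)
open import Function.Definitions using (Injective)
open import Relation.Nullary using (¬_; Dec; yes; no; does; contradiction; ¬?; _⊎-dec_)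
open import Relation.Nullary.Decidable using (dec-true; decidable-stable)
open import Relation.Unary using (Decidable)
open import Relation.Binary.PropositionalEquality using (_≡_; _≢_; _≗_; refl; sym; trans; cong; cong₂; subst; subst₂; module ≡-Reasoning)

private variable
  n : ℕ

-- Rigidity of the cube

flipAt-involutive : (x : Config n) (i : Fin n) → flipAt (flipAt x i) i ≡ x
flipAt-involutive x i = trans (updateAt-updateAt i x)
  (trans (updateAt-cong i Bool.not-involutive x) (updateAt-id i x))

flipAt-comm : (x : Config n) (i j : Fin n) → flipAt (flipAt x i) j ≡ flipAt (flipAt x j) i
flipAt-comm x i j with i ≟ j
... | yes refl = refl
... | no i≢j = updateAt-commutes j i (i≢j ∘ sym) x

flipAt-injective : (i : Fin n) {x y : Config n} → flipAt x i ≡ flipAt y i → x ≡ y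
flipAt-injective i {x} {y} eq =
  trans (sym (flipAt-involutive x i)) (trans (cong (λ z → flipAt z i) eq) (flipAt-involutive y i))

lookup-flipAt : (x : Config n) (i : Fin n) → lookup (flipAt x i) i ≡ not (lookup x i)
lookup-flipAt x i = lookup∘updateAt i x

lookup-flipAt-≢ : (x : Config n) {i j : Fin n} → i ≢ j → lookup (flipAt x i) j ≡ lookup x j
lookup-flipAt-≢ x {i} {j} i≢j = lookup∘updateAt′ j i (i≢j ∘ sym) x

flipAt-index : (x : Config n) {i j : Fin n} → flipAt x i ≡ flipAt x j → i ≡ j
flipAt-index x {i} {j} eq with i ≟ j
... | yes i≡j = i≡j
... | no i≢j = contradiction
  (trans (sym (lookup-flipAt-≢ x (i≢j ∘ sym))) (trans (cong (λ z → lookup z i) (sym eq)) (lookup-flipAt x i)))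
  (Bool.not-¬ refl)

Adj : Config n → Config n → Set
Adj x y = ∃ λ i → y ≡ flipAt x i

Adj-sym : {x y : Config n} → Adj x y → Adj y x
Adj-sym {x = x} (i , refl) = i , sym (flipAt-involutive x i)

-- If `q` or `r` undoes `p`, a single flip remains; otherwise nothing restores coordinate `p`.
flip³-Adj : (a : Config n) (p q r : Fin n) →
  let b = flipAt (flipAt (flipAt a p) q) r in Adj a b ⊎ lookup b p ≡ not (lookup a p)
flip³-Adj a p q r with q ≟ p | r ≟ p
... | yes refl | _ = inj₁ (r , cong (λ z → flipAt z r) (flipAt-involutive a p))
... | no _ | yes refl = inj₁ (q , trans (flipAt-comm (flipAt a p) q p) (cong (λ z → flipAt z q) (flipAt-involutive a p)))
... | no q≢p | no r≢p = inj₂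
  (trans (lookup-flipAt-≢ (flipAt (flipAt a p) q) r≢p)
    (trans (lookup-flipAt-≢ (flipAt a p) q≢p) (lookup-flipAt a p)))

-- Two vertices joined by a path of length three are at distance 1 or 3, and
-- at distance 3 only three first steps are possible.
four-paths⇒Adj : (a b : Config n) (p q r : Fin 4 → Fin n) → Injective _≡_ _≡_ p →
  (∀ t → b ≡ flipAt (flipAt (flipAt a (p t)) (q t)) (r t)) → Adj a b
four-paths⇒Adj a b p q r p-inj path with any? (λ i → ≡-dec Bool._≟_ b (flipAt a i))
... | yes adj = adj
... | no ¬adj = contradiction
  (p-inj (trans (sym (choice-ok t)) (trans (cong support same) (choice-ok t')))) (<⇒≢ t<t')
  where
  support : Fin 3 → Fin _
  support zero = p zero
  support (suc zero) = q zero
  support (suc (suc zero)) = r zero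

  moved : ∀ t → lookup b (p t) ≡ not (lookup a (p t))
  moved t with flip³-Adj a (p t) (q t) (r t)
  ... | inj₁ (i , eq) = contradiction (i , trans (path t) eq) ¬adj
  ... | inj₂ eq = trans (cong (λ z → lookup z (p t)) (path t)) eq

  -- `b` differs from `a` at `p t`, while path `zero` changes no coordinate outside `support`.
  in-support : ∀ t → ∃ λ c → support c ≡ p t
  in-support t with p zero ≟ p t | q zero ≟ p t | r zero ≟ p t
  ... | yes eq | _ | _ = zero , eq
  ... | no _ | yes eq | _ = suc zero , eq
  ... | no _ | no _ | yes eq = suc (suc zero) , eq
  ... | no p≢ | no q≢ | no r≢ = contradiction
    (trans (sym (trans (cong (λ z → lookup z (p t)) (path zero))
      (trans (lookup-flipAt-≢ (flipAt (flipAt a (p zero)) (q zero)) r≢)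
        (trans (lookup-flipAt-≢ (flipAt a (p zero)) q≢) (lookup-flipAt-≢ a p≢))))) (moved t))
    (Bool.not-¬ refl)

  choice : Fin 4 → Fin 3
  choice = proj₁ ∘ in-support

  choice-ok : ∀ t → support (choice t) ≡ p t
  choice-ok = proj₂ ∘ in-support

  collision = pigeonhole (ℕ.n<1+n 3) choice
  t = proj₁ collision
  t' = proj₁ (proj₂ collision)
  t<t' = proj₁ (proj₂ (proj₂ collision))
  same = proj₂ (proj₂ (proj₂ collision))

-- Turn `x` into `y` one coordinate at a time, flipping only where they differ. This passes from
-- invariance along edges to constancy on the cube or on a face.
flipAt-invariant⇒≡ : ∀ {n} {B : Set} (g : Config n → B) (x y : Config n) →
  (∀ i → lookup x i ≡ lookup y i ⊎ (∀ z → g (flipAt z i) ≡ g z)) → g x ≡ g y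
flipAt-invariant⇒≡ g [] [] _ = refl
flipAt-invariant⇒≡ g (a ∷ x) (b ∷ y) inv = trans (head a b (inv zero))
  (flipAt-invariant⇒≡ (g ∘ (b ∷_)) x y λ i → [ inj₁ , (λ h → inj₂ λ z → h (b ∷ z)) ]′ (inv (suc i)))
  where
  head : ∀ a b → (a ≡ b ⊎ (∀ z → g (flipAt z zero) ≡ g z)) → g (a ∷ x) ≡ g (b ∷ x)
  head a b (inj₁ refl) = refl
  head false false (inj₂ h) = refl
  head false true (inj₂ h) = sym (h (false ∷ x))
  head true false (inj₂ h) = sym (h (true ∷ x))
  head true true (inj₂ h) = refl

injective⇒surjective : {σ : Fin n → Fin n} → Injective _≡_ _≡_ σ → ∀ k → ∃ λ i → σ i ≡ k
injective⇒surjective {suc n} {σ} inj k with any? (λ i → σ i ≟ k)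
... | yes found = found
... | no missed = contradiction
  (injective⇒≤ {f = λ i → punchOut {i = k} (λ eq → missed (i , sym eq))}
    (λ {i} {j} eq → inj (punchOut-injective (λ e → missed (i , sym e)) (λ e → missed (j , sym e)) eq)))
  ℕ.1+n≰n

lookup-ext : {x y : Config n} → (∀ i → lookup x i ≡ lookup y i) → x ≡ y
lookup-ext {x = x} {y} h = trans (sym (tabulate∘lookup x)) (trans (tabulate-cong h) (tabulate∘lookup y))

module Automorphism (ψ : Config n → Config n) (ψ-inj : Injective _≡_ _≡_ ψ)
                    (ψ-adj : ∀ u i → Adj (ψ u) (ψ (flipAt u i))) where

  dir : Config n → Fin n → Fin n
  dir u i = proj₁ (ψ-adj u i)

  dir-ok : ∀ u i → ψ (flipAt u i) ≡ flipAt (ψ u) (dir u i)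
  dir-ok u i = proj₂ (ψ-adj u i)

  dir-injective : ∀ u → Injective _≡_ _≡_ (dir u)
  dir-injective u {i} {j} eq = flipAt-index u (ψ-inj
    (trans (dir-ok u i) (trans (cong (flipAt (ψ u)) eq) (sym (dir-ok u j)))))

  -- The square u, u+eᵢ, u+eᵢ+eⱼ, u+eⱼ is mapped to a 4-cycle, whose opposite edges are parallel.
  dir-step : ∀ i u j → dir (flipAt u j) i ≡ dir u i
  dir-step i u j with i ≟ j
  ... | yes refl = flipAt-index (ψ (flipAt u i)) (begin
      flipAt (ψ (flipAt u i)) (dir (flipAt u i) i) ≡⟨ dir-ok (flipAt u i) i ⟨
      ψ (flipAt (flipAt u i) i)                    ≡⟨ cong ψ (flipAt-involutive u i) ⟩
      ψ u                                          ≡⟨ flipAt-involutive (ψ u) (dir u i) ⟨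
      flipAt (flipAt (ψ u) (dir u i)) (dir u i)    ≡⟨ cong (λ z → flipAt z (dir u i)) (dir-ok u i) ⟨
      flipAt (ψ (flipAt u i)) (dir u i)            ∎)
    where open ≡-Reasoning
  ... | no i≢j with dir (flipAt u j) i ≟ dir u i
  ...   | yes eq = eq
  ...   | no D≢A with dir (flipAt u i) j ≟ dir u i
  ...     | yes B≡A = contradiction
            (flipAt-index (flipAt u i)
              (trans (ψ-inj (begin
                ψ (flipAt (flipAt u i) j)                     ≡⟨ dir-ok (flipAt u i) j ⟩
                flipAt (ψ (flipAt u i)) (dir (flipAt u i) j)  ≡⟨ cong₂ flipAt (dir-ok u i) B≡A ⟩
                flipAt (flipAt (ψ u) (dir u i)) (dir u i)     ≡⟨ flipAt-involutive (ψ u) (dir u i) ⟩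
                ψ u                                           ∎))
              (sym (flipAt-involutive u i))))
            (i≢j ∘ sym)
    where open ≡-Reasoning
  -- Both ways round the square end at the same corner, but the way through `u+eᵢ` changes
  -- coordinate `A` and the way through `u+eⱼ` does not.
  ...     | no B≢A = contradiction
            (begin
              not (lookup (ψ u) A)                                   ≡⟨ lookup-flipAt (ψ u) A ⟨
              lookup (flipAt (ψ u) A) A                              ≡⟨ lookup-flipAt-≢ (flipAt (ψ u) A) B≢A ⟨
              lookup (flipAt (flipAt (ψ u) A) (dir (flipAt u i) j)) A ≡⟨ cong (λ z → lookup z A) corner ⟩
              lookup (flipAt (flipAt (ψ u) C) (dir (flipAt u j) i)) A ≡⟨ lookup-flipAt-≢ (flipAt (ψ u) C) D≢A ⟩
              lookup (flipAt (ψ u) C) A                              ≡⟨ lookup-flipAt-≢ (ψ u) (i≢j ∘ sym ∘ dir-injective u) ⟩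
              lookup (ψ u) A                                         ∎)
            (Bool.not-¬ refl ∘ sym)
    where
    open ≡-Reasoning
    A = dir u i
    C = dir u j
    corner : flipAt (flipAt (ψ u) A) (dir (flipAt u i) j) ≡ flipAt (flipAt (ψ u) C) (dir (flipAt u j) i)
    corner = begin
      flipAt (flipAt (ψ u) A) (dir (flipAt u i) j)  ≡⟨ cong (λ z → flipAt z _) (dir-ok u i) ⟨
      flipAt (ψ (flipAt u i)) (dir (flipAt u i) j)  ≡⟨ dir-ok (flipAt u i) j ⟨
      ψ (flipAt (flipAt u i) j)                     ≡⟨ cong ψ (flipAt-comm u i j) ⟩
      ψ (flipAt (flipAt u j) i)                     ≡⟨ dir-ok (flipAt u j) i ⟩
      flipAt (ψ (flipAt u j)) (dir (flipAt u j) i)  ≡⟨ cong (λ z → flipAt z _) (dir-ok u j) ⟩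
      flipAt (flipAt (ψ u) C) (dir (flipAt u j) i)  ∎

  dir-const : ∀ i x y → dir x i ≡ dir y i
  dir-const i x y = flipAt-invariant⇒≡ (λ z → dir z i) x y (λ j → inj₂ λ z → dir-step i z j)

  -- ψ permutes coordinates by dir u (for any base point u) up to complementing some of them.
  lookup-ψ-≡ : ∀ u k x y → lookup x k ≡ lookup y k → lookup (ψ x) (dir u k) ≡ lookup (ψ y) (dir u k)
  lookup-ψ-≡ u k x y eq = flipAt-invariant⇒≡ (λ z → lookup (ψ z) (dir u k)) x y inv
    where
    inv : ∀ i → lookup x i ≡ lookup y i ⊎ (∀ z → lookup (ψ (flipAt z i)) (dir u k) ≡ lookup (ψ z) (dir u k))
    inv i with i ≟ k
    ... | yes refl = inj₁ eq
    ... | no i≢k = inj₂ λ z → trans (cong (λ w → lookup w (dir u k)) (dir-ok z i))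
      (lookup-flipAt-≢ (ψ z) (λ e → i≢k (dir-injective u (trans (dir-const i u z) e))))

  -- Bits being two-valued, `x` agrees with `flipAt u k` at `k`, so `lookup-ψ-≡` applies to these
  -- two.
  lookup-ψ-≢ : ∀ u k x → lookup x k ≢ lookup u k → lookup (ψ x) (dir u k) ≢ lookup (ψ u) (dir u k)
  lookup-ψ-≢ u k x neq eq = Bool.not-¬ refl (begin
      lookup (ψ u) (dir u k)                      ≡⟨ eq ⟨
      lookup (ψ x) (dir u k)                      ≡⟨ lookup-ψ-≡ u k x (flipAt u k) (trans (Bool.¬-not neq) (sym (lookup-flipAt u k))) ⟩
      lookup (ψ (flipAt u k)) (dir u k)           ≡⟨ cong (λ z → lookup z (dir u k)) (dir-ok u k) ⟩
      lookup (flipAt (ψ u) (dir u k)) (dir u k)   ≡⟨ lookup-flipAt (ψ u) (dir u k) ⟩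
      not (lookup (ψ u) (dir u k))                ∎)
    where open ≡-Reasoning

≢-pair⇒≡ : {a b c : Bool} → (a ≢ c → b ≢ c) → (b ≢ c → a ≢ c) → a ≡ b
≢-pair⇒≡ {a} {b} {c} f g with a Bool.≟ c | b Bool.≟ c
... | yes refl | yes refl = refl
... | yes refl | no b≢c = contradiction refl (g b≢c)
... | no a≢c | yes refl = contradiction refl (f a≢c)
... | no a≢c | no b≢c = trans (Bool.¬-not a≢c) (sym (Bool.¬-not b≢c))

AArc-flipAt : {f : BN n} {x : Config n} {i : Fin n} → AArc f x (flipAt x i) → lookup (f x) i ≢ lookup x i
AArc-flipAt {x = x} (j , neq , eq) with refl ← flipAt-index x eq = neq

-- The same `π` serves for the synchronous graphs. Both `h (from u)` and `from (f u)` are compared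
-- with `from u`: at coordinate `dir u i`, the first differs exactly when `𝒜(h)` has the image of
-- the arc from `u` to `u+eᵢ`, the second exactly when `f u` differs from `u` at `i`. These
-- conditions are equivalent under the isomorphism.
cube-automorphism⇒∼ : (h f : BN n) (iso : DigraphIso (AArc h) (AArc f)) →
  (∀ u i → Adj (Inverse.from (proj₁ iso) u) (Inverse.from (proj₁ iso) (flipAt u i))) → h ∼ f
cube-automorphism⇒∼ h f (π , arcs) ψ-adj = π , λ x y → mk⇔
    (λ { refl → sym (inverseˡ (sym (key x))) })
    (λ eq → trans (trans (cong h (sym (strictlyInverseʳ x))) (conj (to x))) (inverseʳ eq))
  where
  open Inverse π
  ψ-inj : Injective _≡_ _≡_ from
  ψ-inj {x} {y} eq = trans (sym (strictlyInverseˡ x)) (trans (cong to eq) (strictlyInverseˡ y))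
  open Automorphism from ψ-inj ψ-adj

  conj : ∀ u → h (from u) ≡ from (f u)
  conj u = lookup-ext λ k → let i , i≡k = injective⇒surjective (dir-injective u) k in
    subst (λ k → lookup (h (from u)) k ≡ lookup (from (f u)) k) i≡k (coordinate i)
    where
    coordinate : ∀ i → lookup (h (from u)) (dir u i) ≡ lookup (from (f u)) (dir u i)
    coordinate i = ≢-pair⇒≡ fwd bwd
      where
      eqv : AArc h (from u) (from (flipAt u i)) ⇔ AArc f u (flipAt u i)
      eqv = subst₂ (λ a b → AArc h (from u) (from (flipAt u i)) ⇔ AArc f a b)
        (strictlyInverseˡ u) (strictlyInverseˡ (flipAt u i)) (arcs (from u) (from (flipAt u i)))
      fwd : lookup (h (from u)) (dir u i) ≢ lookup (from u) (dir u i) → lookup (from (f u)) (dir u i) ≢ lookup (from u) (dir u i)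
      fwd neq = lookup-ψ-≢ u i (f u) (AArc-flipAt {f = f} (Equivalence.to eqv (dir u i , neq , dir-ok u i)))
      bwd : lookup (from (f u)) (dir u i) ≢ lookup (from u) (dir u i) → lookup (h (from u)) (dir u i) ≢ lookup (from u) (dir u i)
      bwd neq = AArc-flipAt {f = h} (subst (AArc h (from u)) (dir-ok u i)
        (Equivalence.from eqv (i , (λ eq → neq (lookup-ψ-≡ u i (f u) u eq)) , refl)))

  key : ∀ x → from (f (to x)) ≡ h x
  key x = trans (sym (conj (to x))) (cong h (strictlyInverseʳ x))

-- Union bounds

select : (p : Subset n) → Fin ∣ p ∣ → Fin n
select (true ∷ p) zero = zero
select (true ∷ p) (suc t) = suc (select p t)
select (false ∷ p) t = suc (select p t)

select-∈ : (p : Subset n) (t : Fin ∣ p ∣) → lookup p (select p t) ≡ true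
select-∈ (true ∷ p) zero = refl
select-∈ (true ∷ p) (suc t) = select-∈ p t
select-∈ (false ∷ p) t = select-∈ p t

select-injective : (p : Subset n) → Injective _≡_ _≡_ (select p)
select-injective (true ∷ p) {zero} {zero} eq = refl
select-injective (true ∷ p) {suc s} {suc t} eq = cong suc (select-injective p (suc-injective eq))
select-injective (false ∷ p) eq = select-injective p (suc-injective eq)

rank : (p : Subset n) (i : Fin n) → lookup p i ≡ true → Fin ∣ p ∣
rank (true ∷ p) zero _ = zero
rank (true ∷ p) (suc i) h = suc (rank p i h)
rank (false ∷ p) (suc i) h = rank p i h

rank-injective : (p : Subset n) {i j : Fin n} (hi : lookup p i ≡ true) (hj : lookup p j ≡ true) →
  rank p i hi ≡ rank p j hj → i ≡ j
rank-injective (true ∷ p) {zero} {zero} _ _ _ = refl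
rank-injective (true ∷ p) {suc i} {suc j} hi hj eq = cong suc (rank-injective p hi hj (suc-injective eq))
rank-injective (false ∷ p) {suc i} {suc j} hi hj eq = cong suc (rank-injective p hi hj eq)

injective⇒≤∣∣ : {m : ℕ} (p : Subset n) (g : Fin m → Fin n) → Injective _≡_ _≡_ g →
  (∀ t → lookup p (g t) ≡ true) → m ≤ ∣ p ∣
injective⇒≤∣∣ p g g-inj g∈p =
  injective⇒≤ {f = λ t → rank p (g t) (g∈p t)} (λ {s} {t} eq → g-inj (rank-injective p (g∈p s) (g∈p t) eq))

subsetOf : {P : Fin n → Set} → Decidable P → Subset n
subsetOf P? = tabulate (does ∘ P?)

subsetOf-sound : {P : Fin n → Set} (P? : Decidable P) (i : Fin n) → lookup (subsetOf P?) i ≡ true → P i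
subsetOf-sound P? i h with P? i | trans (sym (lookup∘tabulate (does ∘ P?) i)) h
... | yes p | _ = p
... | no _ | ()

subsetOf-complete : {P : Fin n → Set} (P? : Decidable P) (i : Fin n) → P i → lookup (subsetOf P?) i ≡ true
subsetOf-complete P? i p = trans (lookup∘tabulate (does ∘ P?) i) (dec-true (P? i) p)

∁-subsetOf-sound : {P : Fin n → Set} (P? : Decidable P) (i : Fin n) → lookup (∁ (subsetOf P?)) i ≡ true → ¬ P i
∁-subsetOf-sound P? i h p = contradiction
  (trans (sym h) (trans (lookup-map i not (subsetOf P?)) (cong not (subsetOf-complete P? i p)))) λ ()

∣∣+∣∁∣ : (p : Subset n) → ∣ p ∣ + ∣ ∁ p ∣ ≡ n
∣∣+∣∁∣ [] = refl
∣∣+∣∁∣ (true ∷ p) = cong suc (∣∣+∣∁∣ p)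
∣∣+∣∁∣ (false ∷ p) = trans (ℕ.+-suc ∣ p ∣ ∣ ∁ p ∣) (cong suc (∣∣+∣∁∣ p))

-- Injections in place of cardinalities can be composed when unsuitable directions are discarded
-- several times in a row.
many-or-few : ∀ {m} {P : Fin m → Set} → Decidable P → ∀ w →
  (∃ λ (τ : Fin w → Fin m) → Injective _≡_ _≡_ τ × (∀ t → P (τ t))) ⊎
  (∃ λ m' → m ≤ w + m' × ∃ λ (σ : Fin m' → Fin m) → Injective _≡_ _≡_ σ × (∀ t → ¬ P (σ t)))
many-or-few P? w with w ≤? ∣ subsetOf P? ∣
... | yes w≤ = inj₁ ((λ t → select A (inject≤ t w≤))
             , (λ {s} {t} eq → inject≤-injective w≤ w≤ s t (select-injective A eq))
             , λ t → subsetOf-sound P? (select A (inject≤ t w≤)) (select-∈ A (inject≤ t w≤)))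
  where A = subsetOf P?
... | no w≰ = inj₂ (∣ ∁ A ∣
            , ℕ.≤-trans (ℕ.≤-reflexive (sym (∣∣+∣∁∣ A))) (ℕ.+-monoˡ-≤ ∣ ∁ A ∣ (ℕ.<⇒≤ (ℕ.≰⇒> w≰)))
            , select (∁ A) , select-injective (∁ A)
            , λ t → ∁-subsetOf-sound P? (select (∁ A) t) (select-∈ (∁ A) t))
  where A = subsetOf P?

-- The set p holds the coordinates forced to be false.
fill : ∀ {M} → Subset M → List (Vec Bool M)
fill [] = [] ∷ []
fill (true ∷ p) = map (false ∷_) (fill p)
fill (false ∷ p) = map (false ∷_) (fill p) ++ map (true ∷_) (fill p)

-- Each forced coordinate halves the count; the product form avoids subtraction in the exponent.
fill-length : ∀ {M} (p : Subset M) → length (fill p) * 2 ^ ∣ p ∣ ≡ 2 ^ M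
fill-length [] = refl
fill-length (true ∷ p) rewrite length-map (Vec._∷_ false) (fill p) = begin
    length (fill p) * (2 * 2 ^ ∣ p ∣) ≡⟨ ℕ.*-comm (length (fill p)) _ ⟩
    2 * 2 ^ ∣ p ∣ * length (fill p)   ≡⟨ ℕ.*-assoc 2 (2 ^ ∣ p ∣) _ ⟩
    2 * (2 ^ ∣ p ∣ * length (fill p)) ≡⟨ cong (2 *_) (ℕ.*-comm (2 ^ ∣ p ∣) _) ⟩
    2 * (length (fill p) * 2 ^ ∣ p ∣) ≡⟨ cong (2 *_) (fill-length p) ⟩
    _ ∎
  where open ≡-Reasoning
fill-length {suc M} (false ∷ p)
  rewrite length-++ (map (Vec._∷_ false) (fill p)) {map (Vec._∷_ true) (fill p)}
        | length-map (Vec._∷_ false) (fill p) | length-map (Vec._∷_ true) (fill p)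
        | ℕ.*-distribʳ-+ (2 ^ ∣ p ∣) (length (fill p)) (length (fill p))
        | fill-length p = cong (2 ^ M +_) (sym (ℕ.+-identityʳ (2 ^ M)))

∈-fill : ∀ {M} (p : Subset M) (v : Vec Bool M) → (∀ i → lookup p i ≡ true → lookup v i ≡ false) → v ∈ fill p
∈-fill [] [] _ = here refl
∈-fill (true ∷ p) (b ∷ v) h with refl ← h zero refl = ∈-map⁺ (false ∷_) (∈-fill p v (h ∘ suc))
∈-fill (false ∷ p) (false ∷ v) h = ∈-++⁺ˡ (∈-map⁺ (false ∷_) (∈-fill p v (h ∘ suc)))
∈-fill (false ∷ p) (true ∷ v) h = ∈-++⁺ʳ _ (∈-map⁺ (true ∷_) (∈-fill p v (h ∘ suc)))

-- Repetitions are allowed, since a union bound asks only for an upper bound on the number of codes.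
-- Sizes are kept as powers of two so that exponents add under products.
record Enum (A : Set) (ℓ : ℕ) : Set where
  field
    elements : List A
    size     : length elements ≤ 2 ^ ℓ
    complete : ∀ a → a ∈ elements
open Enum

length-cartesianProductWith : {A B C : Set} (g : A → B → C) (xs : List A) (ys : List B) →
  length (cartesianProductWith g xs ys) ≡ length xs * length ys
length-cartesianProductWith g [] ys = refl
length-cartesianProductWith g (x ∷ xs) ys = trans (length-++ (map (g x) ys))
  (cong₂ _+_ (length-map (g x) ys) (length-cartesianProductWith g xs ys))

enum-with : {A B C : Set} {k l : ℕ} (g : A → B → C) → (∀ c → ∃ λ a → ∃ λ b → c ≡ g a b) →
  Enum A k → Enum B l → Enum C (k + l)
enum-with {k = k} {l} g onto E F = record
  { elements = cartesianProductWith g (elements E) (elements F)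
  ; size = subst₂ _≤_ (sym (length-cartesianProductWith g (elements E) (elements F)))
      (sym (ℕ.^-distribˡ-+-* 2 k l)) (ℕ.*-mono-≤ (size E) (size F))
  ; complete = λ c → let a , b , eq = onto c in
      subst (_∈ _) (sym eq) (∈-cartesianProductWith⁺ g (complete E a) (complete F b))
  }

enum-× : {A B : Set} {k l : ℕ} → Enum A k → Enum B l → Enum (A × B) (k + l)
enum-× = enum-with _,_ (λ (a , b) → a , b , refl)

enum-Vec : {A : Set} {k : ℕ} → Enum A k → ∀ m → Enum (Vec A m) (m * k)
enum-Vec E zero = record { elements = [] ∷ [] ; size = ℕ.≤-refl ; complete = λ { [] → here refl } }
enum-Vec E (suc m) = enum-with _∷_ (λ { (a ∷ v) → a , v , refl }) E (enum-Vec E m)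

enum-Bool : Enum Bool 1
enum-Bool = record { elements = false ∷ true ∷ [] ; size = ℕ.≤-refl
                   ; complete = λ { false → here refl ; true → there (here refl) } }

enum-Fin : ∀ {m k} → m ≤ 2 ^ k → Enum (Fin m) k
enum-Fin {m} m≤ = record { elements = allFin m
                         ; size = subst (_≤ _) (sym (length-tabulate {n = m} (λ i → i))) m≤
                         ; complete = ∈-allFin }

-- The union bound in counting form: a fraction `2^(-z)` of all vectors vanishes on `z` given
-- distinct positions, so at most `2^ℓ` codes account for a fraction of at most `2^(ℓ-z)`.
module Cover {M z ℓ : ℕ} {C : Set} (E : Enum C ℓ) (Z : C → Fin z → Fin M) where

  hit? : ∀ c i → Dec (∃ λ t → Z c t ≡ i)
  hit? c i = any? λ t → Z c t ≟ i

  mask : C → Subset M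
  mask c = subsetOf (hit? c)

  -- Codes whose positions are not distinct are dropped, so that the size bound holds for every code.
  piece : C → List (Vec Bool M)
  piece c with z ≤? ∣ mask c ∣
  ... | yes _ = fill (mask c)
  ... | no _ = []

  piece-length : ∀ c → length (piece c) * 2 ^ z ≤ 2 ^ M
  piece-length c with z ≤? ∣ mask c ∣
  ... | yes z≤ = ℕ.≤-trans (ℕ.*-monoʳ-≤ (length (fill (mask c))) (ℕ.^-monoʳ-≤ 2 z≤)) (ℕ.≤-reflexive (fill-length (mask c)))
  ... | no _ = z≤n

  pieces : List C → List (Vec Bool M)
  pieces [] = []
  pieces (c ∷ cs) = piece c ++ pieces cs

  pieces-length : ∀ cs → length (pieces cs) * 2 ^ z ≤ length cs * 2 ^ M
  pieces-length [] = z≤n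
  pieces-length (c ∷ cs)
    rewrite length-++ (piece c) {pieces cs} | ℕ.*-distribʳ-+ (2 ^ z) (length (piece c)) (length (pieces cs))
    = ℕ.+-mono-≤ (piece-length c) (pieces-length cs)

  ∈-piece : ∀ c → Injective _≡_ _≡_ (Z c) → (v : Vec Bool M) → (∀ t → lookup v (Z c t) ≡ false) → v ∈ piece c
  ∈-piece c Z-inj v v-false with z ≤? ∣ mask c ∣
  ... | yes _ = ∈-fill (mask c) v λ i h → let t , eq = subsetOf-sound (hit? c) i h in subst (λ i → lookup v i ≡ false) eq (v-false t)
  ... | no z≰ = contradiction (injective⇒≤∣∣ (mask c) (Z c) Z-inj (λ t → subsetOf-complete (hit? c) (Z c t) (t , refl))) z≰

  ∈-pieces : ∀ {c v cs} → c ∈ cs → v ∈ piece c → v ∈ pieces cs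
  ∈-pieces (here refl) h = ∈-++⁺ˡ h
  ∈-pieces {cs = c' ∷ _} (there c∈) h = ∈-++⁺ʳ (piece c') (∈-pieces c∈ h)

  abstract
    cover : List (Vec Bool M)
    cover = pieces (elements E)

    cover-length : ∀ {K} → ℓ + K ≤ z → length cover * 2 ^ K ≤ 2 ^ M
    cover-length {K} ℓ+K≤z = ℕ.*-cancelˡ-≤ (2 ^ ℓ) {{ℕ.m^n≢0 2 ℓ}} (begin
        2 ^ ℓ * (length cover * 2 ^ K)  ≡⟨ ℕ.*-comm (2 ^ ℓ) _ ⟩
        length cover * 2 ^ K * 2 ^ ℓ    ≡⟨ ℕ.*-assoc (length cover) (2 ^ K) (2 ^ ℓ) ⟩
        length cover * (2 ^ K * 2 ^ ℓ)  ≡⟨ cong (length cover *_) (ℕ.*-comm (2 ^ K) (2 ^ ℓ)) ⟩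
        length cover * (2 ^ ℓ * 2 ^ K)  ≡⟨ cong (length cover *_) (ℕ.^-distribˡ-+-* 2 ℓ K) ⟨
        length cover * 2 ^ (ℓ + K)      ≤⟨ ℕ.*-monoʳ-≤ (length cover) (ℕ.^-monoʳ-≤ 2 ℓ+K≤z) ⟩
        length cover * 2 ^ z            ≤⟨ pieces-length (elements E) ⟩
        length (elements E) * 2 ^ M     ≤⟨ ℕ.*-monoˡ-≤ (2 ^ M) (size E) ⟩
        2 ^ ℓ * 2 ^ M                   ∎)
      where open ℕ.≤-Reasoning

    ∈-cover : ∀ c → Injective _≡_ _≡_ (Z c) → (v : Vec Bool M) → (∀ t → lookup v (Z c t) ≡ false) → v ∈ cover
    ∈-cover c Z-inj v v-false = ∈-pieces (complete E c) (∈-piece c Z-inj v v-false)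

-- Networks as vectors of arc bits

bit : Bool → Fin 2
bit false = zero
bit true = suc zero

unbit : Fin 2 → Bool
unbit zero = false
unbit (suc zero) = true

unbit-bit : ∀ b → unbit (bit b) ≡ b
unbit-bit false = refl
unbit-bit true = refl

encode : Config n → Fin (2 ^ n)
encode [] = zero
encode {suc n} (b ∷ x) = combine {2} {2 ^ n} (bit b) (encode x)

decode : Fin (2 ^ n) → Config n
decode {zero} _ = []
decode {suc n} t = let b , x = remQuot {2} (2 ^ n) t in unbit b ∷ decode x

decode-encode : (x : Config n) → decode (encode x) ≡ x
decode-encode [] = refl
decode-encode {suc n} (b ∷ x) = cong₂ _∷_
  (trans (cong (unbit ∘ proj₁) (remQuot-combine {2} {2 ^ n} (bit b) (encode x))) (unbit-bit b))
  (trans (cong (decode ∘ proj₂) (remQuot-combine {2} {2 ^ n} (bit b) (encode x))) (decode-encode x))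

Slot : ℕ → Set
Slot n = Config n × Fin n

slot : Slot n → Fin (2 ^ n * n)
slot (x , i) = combine (encode x) i

unslot : Fin (2 ^ n * n) → Slot n
unslot {n} t = let x , i = remQuot {2 ^ n} n t in decode x , i

unslot-slot : (a : Slot n) → unslot (slot a) ≡ a
unslot-slot (x , i) = cong₂ _,_
  (trans (cong (decode ∘ proj₁) (remQuot-combine (encode x) i)) (decode-encode x))
  (cong proj₂ (remQuot-combine (encode x) i))

slot-injective : {a b : Slot n} → slot a ≡ slot b → a ≡ b
slot-injective {a = a} {b} eq = trans (sym (unslot-slot a)) (trans (cong unslot eq) (unslot-slot b))

-- True exactly when `𝒜(f)` has the arc from `x` to `x+eᵢ`. For a uniform network these bits are
-- independent and fair.
arc : BN n → Slot n → Bool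
arc f (x , i) = lookup (f x) i xor lookup x i

table : BN n → Vec Bool (2 ^ n * n)
table f = tabulate (arc f ∘ unslot)

lookup-table : (f : BN n) (a : Slot n) → lookup (table f) (slot a) ≡ arc f a
lookup-table f a = trans (lookup∘tabulate _ (slot a)) (cong (arc f) (unslot-slot a))

fromTable : Vec Bool (2 ^ n * n) → BN n
fromTable v x = tabulate λ i → lookup v (slot (x , i)) xor lookup x i

fromTable-table : (f : BN n) → f ≗ fromTable (table f)
fromTable-table f x = lookup-ext λ i → begin
    lookup (f x) i                                     ≡⟨ Bool.xor-identityʳ _ ⟨
    lookup (f x) i xor false                           ≡⟨ cong (lookup (f x) i xor_) (Bool.xor-same (lookup x i)) ⟨
    lookup (f x) i xor (lookup x i xor lookup x i)     ≡⟨ Bool.xor-assoc (lookup (f x) i) _ _ ⟨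
    arc f (x , i) xor lookup x i                       ≡⟨ cong (_xor lookup x i) (lookup-table f (x , i)) ⟨
    lookup (table f) (slot (x , i)) xor lookup x i     ≡⟨ lookup∘tabulate _ i ⟨
    lookup (fromTable (table f) x) i                   ∎
  where open ≡-Reasoning

remQuot-injective : ∀ {m} k {s t : Fin (m * k)} → remQuot {m} k s ≡ remQuot k t → s ≡ t
remQuot-injective {m} k {s} {t} eq =
  trans (sym (combine-remQuot {m} k s)) (trans (cong (uncurry combine) eq) (combine-remQuot {m} k t))

-- Networks with too many absent edges

parity : Config n → Bool
parity [] = false
parity (b ∷ x) = b xor parity x

parity-flipAt : (x : Config n) (i : Fin n) → parity (flipAt x i) ≡ not (parity x)
parity-flipAt (b ∷ x) zero = sym (Bool.not-distribˡ-xor b (parity x))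
parity-flipAt (b ∷ x) (suc i) = trans (cong (b xor_) (parity-flipAt x i)) (sym (Bool.not-distribʳ-xor b (parity x)))

-- A slot (x , i) is also used to name the undirected edge {x, x+eᵢ}; its two arcs are then its endpoints,
-- told apart by parity.
endpoint : Fin 2 → Slot n → Slot n
endpoint zero a = a
endpoint (suc zero) (x , i) = flipAt x i , i

-- The cube is bipartite: if edges are named from base points of one colour, an arc reveals by its
-- parity which endpoint it leaves, and hence its edge. Distinct edges so named therefore occupy
-- disjoint pairs of bits.
endpoint-injective : ∀ s s' (a a' : Slot n) → parity (proj₁ a) ≡ parity (proj₁ a') →
  endpoint s a ≡ endpoint s' a' → a ≡ a' × s ≡ s'
endpoint-injective zero zero a a' _ eq = eq , refl
endpoint-injective (suc zero) (suc zero) (x , i) (x' , i') _ eq with ,-injective eq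
... | eq₁ , refl = cong (_, i) (flipAt-injective i eq₁) , refl
endpoint-injective zero (suc zero) (x , i) (x' , i') par eq = contradiction
  (trans (sym par) (trans (cong (parity ∘ proj₁) eq) (parity-flipAt x' i'))) (Bool.not-¬ refl)
endpoint-injective (suc zero) zero (x , i) (x' , i') par eq = contradiction
  (trans par (trans (cong (parity ∘ proj₁) (sym eq)) (parity-flipAt x i))) (Bool.not-¬ refl)

present : BN n → Slot n → Bool
present f a = arc f (endpoint zero a) ∨ arc f (endpoint (suc zero) a)

-- An absent edge fixes two bits of the table, whence the probability `1/4`.
absent⇒arc-false : (f : BN n) (a : Slot n) → present f a ≡ false → ∀ s → arc f (endpoint s a) ≡ false
absent⇒arc-false f a h s with arc f (endpoint zero a) in eq₀ | arc f (endpoint (suc zero) a) in eq₁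
absent⇒arc-false f a h zero | false | false = eq₀
absent⇒arc-false f a h (suc zero) | false | false = eq₁

-- The junk value for small p keeps select≤ injective.
select≤ : ∀ {m} → m ≤ n → Subset n → Fin m → Fin n
select≤ {m = m} m≤n p t with m ≤? ∣ p ∣
... | yes m≤∣p∣ = select p (inject≤ t m≤∣p∣)
... | no _ = inject≤ t m≤n

select≤-injective : ∀ {m} (m≤n : m ≤ n) (p : Subset n) → Injective _≡_ _≡_ (select≤ m≤n p)
select≤-injective {m = m} m≤n p {s} {t} eq with m ≤? ∣ p ∣
... | yes m≤∣p∣ = inject≤-injective m≤∣p∣ m≤∣p∣ s t (select-injective p eq)
... | no _ = inject≤-injective m≤n m≤n s t eq

select≤-∈ : ∀ {m} (m≤n : m ≤ n) (p : Subset n) → m ≤ ∣ p ∣ → ∀ t → lookup p (select≤ m≤n p t) ≡ true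
select≤-∈ {m = m} m≤n p m≤∣p∣ t with m ≤? ∣ p ∣
... | yes h = select-∈ p (inject≤ t h)
... | no m≰ = contradiction m≤∣p∣ m≰

-- Grouping the directions into blocks of two bounds the number of choices of the absent edges by 2^(g+a)
-- instead of a binomial coefficient.
module Dense {n g a ℓ : ℕ} {C : Set} (E : Enum C ℓ) (room : (g + a) * 2 ≤ n)
             (ε : C → Fin n → Slot n) (ε-injective : ∀ c → Injective _≡_ _≡_ (ε c))
             (ε-parity : ∀ c i j → parity (proj₁ (ε c i)) ≡ parity (proj₁ (ε c j))) where

  block : Fin (g + a) → Fin 2 → Fin n
  block p k = inject≤ (combine p k) room

  block-injective : ∀ {p p' k k'} → block p k ≡ block p' k' → p ≡ p' × k ≡ k'
  block-injective {p} {p'} {k} {k'} eq = combine-injective p k p' k'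
    (inject≤-injective room room (combine p k) (combine p' k') eq)

  blockOf : Subset (g + a) → Fin a → Fin (g + a)
  blockOf = select≤ (ℕ.m≤n+m a g)

  edge : C × Subset (g + a) → Fin (a * 2) → Slot n
  edge (c , S) r = let p , k = remQuot 2 r in ε c (block (blockOf S p) k)

  edge-injective : ∀ d → Injective _≡_ _≡_ (edge d)
  edge-injective (c , S) {r} {r'} eq = let block≡ , k≡ = block-injective (ε-injective c eq) in
    remQuot-injective {a} 2 (cong₂ _,_ (select≤-injective (ℕ.m≤n+m a g) S block≡) k≡)

  -- There are `a` blocks, two edges in each block and two arcs on each edge.
  positions : C × Subset (g + a) → Fin (a * 2 * 2) → Fin (2 ^ n * n)
  positions d t = let r , s = remQuot {a * 2} 2 t in slot (endpoint s (edge d r))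

  positions-injective : ∀ d → Injective _≡_ _≡_ (positions d)
  positions-injective d@(c , _) {t} {t'} eq =
    let edge≡ , s≡ = endpoint-injective (side t) (side t') (edge d (pair t)) (edge d (pair t'))
                       (ε-parity c _ _) (slot-injective eq)
    in remQuot-injective {a * 2} 2 (cong₂ _,_ (edge-injective d edge≡) s≡)
    where
    pair : Fin (a * 2 * 2) → Fin (a * 2)
    pair = proj₁ ∘ remQuot {a * 2} 2
    side : Fin (a * 2 * 2) → Fin 2
    side = proj₂ ∘ remQuot {a * 2} 2

  open Cover (enum-× E (enum-Vec enum-Bool (g + a))) positions public using (cover; cover-length; ∈-cover)

  -- Either `g` blocks contain a present edge, and one is taken from each, or at least `a` blocks
  -- are wholly absent, and then the set of these blocks gives a code that puts `table f` in
  -- `cover`.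
  many-present : ∀ f → ¬ table f ∈ cover → ∀ c →
    ∃ λ (j : Fin g → Fin n) → Injective _≡_ _≡_ j × (∀ t → present f (ε c (j t)) ≡ true)
  many-present f f∉ c = result
    where
    hit? : ∀ p → Dec (∃ λ k → present f (ε c (block p k)) ≡ true)
    hit? p = any? λ k → present f (ε c (block p k)) Bool.≟ true
    S = subsetOf hit?

    result : ∃ λ (j : Fin g → Fin n) → Injective _≡_ _≡_ j × (∀ t → present f (ε c (j t)) ≡ true)
    result with g ≤? ∣ S ∣
    ... | yes g≤ = (λ t → block (p t) (proj₁ (hit t)))
                 , (λ {t} {t'} eq → inject≤-injective g≤ g≤ t t' (select-injective S (proj₁ (block-injective eq))))
                 , λ t → proj₂ (hit t)
      where
      p : Fin g → Fin (g + a)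
      p t = select S (inject≤ t g≤)
      hit : ∀ t → ∃ λ k → present f (ε c (block (p t) k)) ≡ true
      hit t = subsetOf-sound hit? (p t) (select-∈ S (inject≤ t g≤))
    ... | no g≰ = contradiction
        (∈-cover (c , ∁ S) (positions-injective (c , ∁ S)) (table f) λ t →
          let r , s = remQuot {a * 2} 2 t in
          trans (lookup-table f _) (absent⇒arc-false f (edge (c , ∁ S) r) (missed r) s))
        f∉
      where
      a≤ : a ≤ ∣ ∁ S ∣
      a≤ = ℕ.+-cancelˡ-≤ g a ∣ ∁ S ∣ (ℕ.≤-trans (ℕ.≤-reflexive (sym (∣∣+∣∁∣ S)))
             (ℕ.+-monoˡ-≤ ∣ ∁ S ∣ (ℕ.<⇒≤ (ℕ.≰⇒> g≰))))
      missed : ∀ r → present f (edge (c , ∁ S) r) ≡ false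
      missed r = let p , k = remQuot {a} 2 r in Bool.¬-not λ h →
        ∁-subsetOf-sound hit? (blockOf (∁ S) p) (select≤-∈ (ℕ.m≤n+m a g) (∁ S) a≤ p) (k , h)

-- The two edges of the square u, u+eⱼ, u+eⱼ+eₖ, u+eₖ not incident to u.
chord : Config n → Fin n → Fin n → Bool → Slot n
chord u j k false = flipAt u j , k
chord u j k true = flipAt u k , j

chord-parity : ∀ (u : Config n) j k b → parity (proj₁ (chord u j k b)) ≡ not (parity u)
chord-parity u j k false = parity-flipAt u j
chord-parity u j k true = parity-flipAt u k

-- A coincidence between chords of different kinds would exchange the roles of the two directions,
-- which the inequalities forbid.
chord-injective : ∀ (u : Config n) {j j' k k'} b b' → j ≢ k' → j' ≢ k →
  chord u j k b ≡ chord u j' k' b' → j ≡ j' × k ≡ k'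
chord-injective u false false _ _ eq = let x≡ , i≡ = ,-injective eq in flipAt-index u x≡ , i≡
chord-injective u false true _ j'≢k eq = contradiction (sym (proj₂ (,-injective eq))) j'≢k
chord-injective u true false j≢k' _ eq = contradiction (proj₂ (,-injective eq)) j≢k'
chord-injective u true true _ _ eq = let x≡ , i≡ = ,-injective eq in i≡ , flipAt-index u x≡

-- Some group `g` of `w` directions yields no square with both chords present. If no group is like
-- this, each of the four yields a square, and `four-paths⇒Adj` asks for exactly four.
Broken : ∀ {w} → BN n → Config n → (Fin (4 * w) → Fin n) → Fin n → Set
Broken {w = w} f u D j = ∃ λ (g : Fin 4) → ∀ (y : Fin w) →
  ∃ λ b → present f (chord u j (D (combine g y)) b) ≡ false

-- D lists 4w directions in four groups of w, J the directions that fail, G for each of them the group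
-- without a complete square, and B for each square an absent edge.
module Sparse {n w ℓ : ℕ} (n≤ : n ≤ 2 ^ ℓ) where

  Code : Set
  Code = Config n × (Vec (Fin n) (4 * w) × (Vec (Fin n) w × (Vec (Fin 4) w × Vec (Vec Bool w) w)))

  enum-Code : Enum Code (n * 1 + (4 * w * ℓ + (w * ℓ + (w * 2 + w * (w * 1)))))
  enum-Code = enum-× (enum-Vec enum-Bool n) (enum-× (enum-Vec (enum-Fin n≤) (4 * w))
    (enum-× (enum-Vec (enum-Fin n≤) w) (enum-× (enum-Vec (enum-Fin ℕ.≤-refl) w)
      (enum-Vec (enum-Vec enum-Bool w) w))))

  edge : Code → Fin w × Fin w → Slot n
  edge (u , D , J , G , B) (x , y) =
    chord u (lookup J x) (lookup D (combine (lookup G x) y)) (lookup (lookup B x) y)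

  edge-parity : ∀ c r → parity (proj₁ (edge c r)) ≡ not (parity (proj₁ c))
  edge-parity (u , D , J , G , B) (x , y) = chord-parity u _ _ (lookup (lookup B x) y)

  Proper : Code → Set
  Proper (u , D , J , _) =
    Injective _≡_ _≡_ (lookup D) × Injective _≡_ _≡_ (lookup J) × (∀ x y → lookup J x ≢ lookup D y)

  edge-injective : ∀ c → Proper c → Injective _≡_ _≡_ (edge c)
  edge-injective (u , D , J , G , B) (D-inj , J-inj , disjoint) {x , y} {x' , y'} eq
    with J≡ , D≡ ← chord-injective u (lookup (lookup B x) y) (lookup (lookup B x') y')
           (disjoint x _) (disjoint x' _) eq
    with refl ← J-inj J≡
    = cong (x ,_) (proj₂ (combine-injective (lookup G x) y (lookup G x) y' (D-inj D≡)))

  positions : Code → Fin (w * w * 2) → Fin (2 ^ n * n)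
  positions c t = let r , s = remQuot {w * w} 2 t in slot (endpoint s (edge c (remQuot {w} w r)))

  positions-injective : ∀ c → Proper c → Injective _≡_ _≡_ (positions c)
  positions-injective c proper {t} {t'} eq =
    let edge≡ , s≡ = endpoint-injective (side t) (side t') (edge c (pair t)) (edge c (pair t'))
                       (trans (edge-parity c (pair t)) (sym (edge-parity c (pair t')))) (slot-injective eq)
    in remQuot-injective {w * w} 2 (cong₂ _,_ (remQuot-injective {w} w (edge-injective c proper edge≡)) s≡)
    where
    pair : Fin (w * w * 2) → Fin w × Fin w
    pair = remQuot {w} w ∘ proj₁ ∘ remQuot {w * w} 2
    side : Fin (w * w * 2) → Fin 2
    side = proj₂ ∘ remQuot {w * w} 2

  open Cover enum-Code positions public using (cover; cover-length; ∈-cover)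

  -- The witnesses of `Broken` supply the components `G` and `B` of a code, whose `w * w` chords are
  -- all absent.
  few-broken : ∀ f → ¬ table f ∈ cover → ∀ u (D : Fin (4 * w) → Fin n) (J : Fin w → Fin n) →
    Injective _≡_ _≡_ D → Injective _≡_ _≡_ J → (∀ x y → J x ≢ D y) → ¬ (∀ x → Broken f u D (J x))
  few-broken f f∉ u D J D-inj J-inj disjoint broken =
    f∉ (∈-cover code (positions-injective code proper) (table f) λ t →
      let r , s = remQuot {w * w} 2 t ; x , y = remQuot {w} w r in
      trans (lookup-table f _) (absent⇒arc-false f (edge code (x , y)) (edge-absent x y) s))
    where
    side : Fin w → Fin w → Bool
    side x y = proj₁ (proj₂ (broken x) y)
    code : Code
    code = u , tabulate D , tabulate J , tabulate (proj₁ ∘ broken) , tabulate (λ x → tabulate (side x))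
    proper : Proper code
    proper = (λ {x} {y} eq → D-inj (trans (sym (lookup∘tabulate D x)) (trans eq (lookup∘tabulate D y))))
           , (λ {x} {y} eq → J-inj (trans (sym (lookup∘tabulate J x)) (trans eq (lookup∘tabulate J y))))
           , λ x y eq → disjoint x y (trans (sym (lookup∘tabulate J x)) (trans eq (lookup∘tabulate D y)))
    edge-absent : ∀ x y → present f (edge code (x , y)) ≡ false
    edge-absent x y
      rewrite lookup∘tabulate (λ x → tabulate (side x)) x | lookup∘tabulate (side x) y
            | lookup∘tabulate (proj₁ ∘ broken) x | lookup∘tabulate J x
            | lookup∘tabulate D (combine (proj₁ (broken x)) y) = proj₂ (proj₂ (broken x) y)

-- Isomorphisms preserve the edges of the cube

module EdgePreservation (h f : BN n) (iso : DigraphIso (AArc h) (AArc f)) where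
  open Inverse (proj₁ iso)

  Kept : Config n → Fin n → Set
  Kept u i = Adj (from u) (from (flipAt u i))

  from-injective : Injective _≡_ _≡_ from
  from-injective {x} {y} eq = trans (sym (strictlyInverseˡ x)) (trans (cong to eq) (strictlyInverseˡ y))

  AArc⇒Adj : ∀ {x y} → AArc f x y → Adj (from x) (from y)
  AArc⇒Adj {x} {y} arrow
    with i , _ , eq ← Equivalence.from (proj₂ iso (from x) (from y))
                        (subst₂ (AArc f) (sym (strictlyInverseˡ x)) (sym (strictlyInverseˡ y)) arrow)
    = i , eq

  arc⇒Kept : ∀ u i → arc f (u , i) ≡ true → Kept u i
  arc⇒Kept u i h = AArc⇒Adj (i , (λ eq → contradiction
    (trans (sym h) (trans (cong (_xor lookup u i) eq) (Bool.xor-same (lookup u i)))) λ ()) , refl)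

  present⇒Kept : ∀ u i → present f (u , i) ≡ true → Kept u i
  present⇒Kept u i h with arc f (u , i) in eq₀ | arc f (flipAt u i , i) in eq₁
  ... | true | _ = arc⇒Kept u i eq₀
  ... | false | true = Adj-sym (subst (λ x → Adj (from (flipAt u i)) (from x)) (flipAt-involutive u i)
                                  (arc⇒Kept (flipAt u i) i eq₁))

  -- Each square on the edge gives a path of length three between the images of its ends. The first
  -- steps are distinct because `from` is injective.
  squares⇒Kept : ∀ u i (j : Fin 4 → Fin n) → Injective _≡_ _≡_ j →
    (∀ t → Kept u (j t)) → (∀ t → Kept (flipAt u (j t)) i) → (∀ t → Kept (flipAt u i) (j t)) → Kept u i
  squares⇒Kept u i j j-inj first middle last = four-paths⇒Adj (from u) (from (flipAt u i))
    (λ t → proj₁ (first t)) (λ t → proj₁ (middle t)) (λ t → proj₁ (last t))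
    (λ {s} {t} eq → j-inj (flipAt-index u (from-injective
      (trans (proj₂ (first s)) (trans (cong (flipAt (from u)) eq) (sym (proj₂ (first t))))))))
    path
    where
    path : ∀ t → from (flipAt u i) ≡
      flipAt (flipAt (flipAt (from u) (proj₁ (first t))) (proj₁ (middle t))) (proj₁ (last t))
    path t with first t | middle t | last t
    ... | p , eqp | q , eqq | r , eqr = begin
      from (flipAt u i)                                      ≡⟨ flipAt-involutive _ r ⟨
      flipAt (flipAt (from (flipAt u i)) r) r                ≡⟨ cong (λ z → flipAt z r) eqr ⟨
      flipAt (from (flipAt (flipAt u i) (j t))) r            ≡⟨ cong (λ z → flipAt (from z) r) (flipAt-comm u i (j t)) ⟩
      flipAt (from (flipAt (flipAt u (j t)) i)) r            ≡⟨ cong (λ z → flipAt z r) eqq ⟩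
      flipAt (flipAt (from (flipAt u (j t))) q) r            ≡⟨ cong (λ z → flipAt (flipAt z q) r) eqp ⟩
      flipAt (flipAt (flipAt (from u) p) q) r                ∎
      where open ≡-Reasoning

module Rigidity {n w : ℕ} (2≤w : 2 ≤ w) (f : BN n)
  (star : ∀ u → ∃ λ (D : Fin (4 * w) → Fin n) → Injective _≡_ _≡_ D × (∀ t → present f (u , D t) ≡ true))
  (ladder : ∀ u i → ∃ λ (j : Fin (4 * w) → Fin n) →
    Injective _≡_ _≡_ j × (∀ t → present f (flipAt u (j t) , i) ≡ true))
  (few-broken : ∀ u (D : Fin (4 * w) → Fin n) (J : Fin w → Fin n) →
    Injective _≡_ _≡_ D → Injective _≡_ _≡_ J → (∀ x y → J x ≢ D y) → ¬ (∀ x → Broken {w = w} f u D (J x))) where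

  D : Config n → Fin (4 * w) → Fin n
  D u = proj₁ (star u)

  BothPresent : Config n → Fin n → Fin n → Set
  BothPresent u j k = ∀ b → present f (chord u j k b) ≡ true

  bothPresent? : ∀ u j k → Dec (BothPresent u j k)
  bothPresent? u j k with present f (chord u j k false) Bool.≟ true
                        | present f (chord u j k true) Bool.≟ true
  ... | yes p | yes q = yes λ { false → p ; true → q }
  ... | no ¬p | _ = no λ h → ¬p (h false)
  ... | yes _ | no ¬q = no λ h → ¬q (h true)

  ¬bothPresent : ∀ u j k → ¬ BothPresent u j k → ∃ λ b → present f (chord u j k b) ≡ false
  ¬bothPresent u j k ¬h with present f (chord u j k false) in eq₀ | present f (chord u j k true) in eq₁
  ... | false | _ = false , eq₀
  ... | true | false = true , eq₁
  ... | true | true = contradiction (λ { false → eq₀ ; true → eq₁ }) ¬h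

  Spanned : Config n → Fin n → Fin 4 → Set
  Spanned u j g = ∃ λ (y : Fin w) → BothPresent u j (D u (combine g y))

  spanned? : ∀ u j g → Dec (Spanned u j g)
  spanned? u j g = any? λ y → bothPresent? u j (D u (combine g y))

  -- A sufficient reason, decidable from `f` alone, for every isomorphism to keep the edge.
  Settled : Config n → Fin n → Set
  Settled u j = present f (u , j) ≡ true ⊎ (∀ g → Spanned u j g)

  settled? : ∀ u j → Dec (Settled u j)
  settled? u j = (present f (u , j) Bool.≟ true) ⊎-dec all? (spanned? u j)

  ¬settled⇒broken : ∀ u j → ¬ Settled u j → Broken f u (D u) j
  ¬settled⇒broken u j ¬s =
    let g , ¬span = ¬∀⟶∃¬ 4 (Spanned u j) (spanned? u j) (¬s ∘ inj₂) in
    g , λ y → ¬bothPresent u j (D u (combine g y)) λ both → ¬span (y , both)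

  -- Directions in `D u` have present edges and so are settled; hence `J` avoids them, as
  -- `few-broken` requires.
  few-unsettled : ∀ u (J : Fin w → Fin n) → Injective _≡_ _≡_ J → ¬ (∀ t → ¬ Settled u (J t))
  few-unsettled u J J-inj unsettled = few-broken u (D u) J (proj₁ (proj₂ (star u))) J-inj
    (λ x y eq → unsettled x (inj₁ (subst (λ k → present f (u , k) ≡ true) (sym eq) (proj₂ (proj₂ (star u)) y))))
    (λ x → ¬settled⇒broken u (J x) (unsettled x))

  mostly-settled : ∀ u {m} (j : Fin m → Fin n) → Injective _≡_ _≡_ j →
    ∃ λ m' → m ≤ w + m' × ∃ λ (σ : Fin m' → Fin m) → Injective _≡_ _≡_ σ × (∀ t → Settled u (j (σ t)))
  mostly-settled u j j-inj = [ many , few ]′ (many-or-few (λ t → ¬? (settled? u (j t))) w)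
    where
    many = λ (τ , τ-inj , unsettled) → contradiction unsettled (few-unsettled u (j ∘ τ) (τ-inj ∘ j-inj))
    few = λ (m' , m≤ , σ , σ-inj , ¬¬settled) →
      m' , m≤ , σ , (λ {x} {y} → σ-inj {x} {y}) , λ t → decidable-stable (settled? u (j (σ t))) (¬¬settled t)

  module _ (h : BN n) (iso : DigraphIso (AArc h) (AArc f)) where
    open EdgePreservation h f iso

    settled⇒Kept : ∀ u j → Settled u j → Kept u j
    settled⇒Kept u j (inj₁ p) = present⇒Kept u j p
    settled⇒Kept u j (inj₂ span) = squares⇒Kept u j k
      -- The four directions lie in different groups of `D u`, so they are distinct.
      (λ {g} {g'} eq → proj₁ (combine-injective g (y g) g' (y g') (proj₁ (proj₂ (star u)) eq)))
      (λ g → present⇒Kept u (k g) (proj₂ (proj₂ (star u)) (combine g (y g))))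
      (λ g → present⇒Kept (flipAt u (k g)) j (proj₂ (span g) true))
      (λ g → present⇒Kept (flipAt u j) (k g) (proj₂ (span g) false))
      where
      y : Fin 4 → Fin w
      y g = proj₁ (span g)
      k : Fin 4 → Fin n
      k g = D u (combine g (y g))

    -- Among the `4w` directions of present rungs, at most `w` are lost as unsettled at `u` and at
    -- most `w` more at `u+eᵢ`. At least `2w`, hence four, remain, and their squares have three kept
    -- edges.
    all-Kept : ∀ u i → Kept u i
    all-Kept u i
      with j , j-inj , rungs ← ladder u i
      with m₁ , 4w≤ , σ , σ-inj , settled₁ ← mostly-settled u j j-inj
      with m₂ , m₁≤ , τ , τ-inj , settled₂ ← mostly-settled (flipAt u i) (j ∘ σ) (σ-inj ∘ j-inj)
      = squares⇒Kept u i (j ∘ σ ∘ τ ∘ ρ)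
          (λ {s} {t} eq → inject≤-injective 4≤m₂ 4≤m₂ s t (τ-inj (σ-inj (j-inj eq))))
          (λ t → settled⇒Kept u (j (σ (τ (ρ t)))) (settled₁ (τ (ρ t))))
          (λ t → present⇒Kept (flipAt u (j (σ (τ (ρ t))))) i (rungs (σ (τ (ρ t)))))
          (λ t → settled⇒Kept (flipAt u i) (j (σ (τ (ρ t)))) (settled₂ (ρ t)))
      where
      4≤m₂ : 4 ≤ m₂
      4≤m₂ = ℕ.+-cancelˡ-≤ (w + w) 4 m₂ (begin
        w + w + 4          ≤⟨ ℕ.+-monoʳ-≤ (w + w) (ℕ.+-mono-≤ 2≤w 2≤w) ⟩
        w + w + (w + w)    ≡⟨ ℕ.+-assoc w w (w + w) ⟩
        w + (w + (w + w))  ≡⟨ cong (λ z → w + (w + (w + z))) (ℕ.+-identityʳ w) ⟨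
        4 * w              ≤⟨ 4w≤ ⟩
        w + m₁             ≤⟨ ℕ.+-monoʳ-≤ w m₁≤ ⟩
        w + (w + m₂)       ≡⟨ ℕ.+-assoc w w m₂ ⟨
        w + w + m₂         ∎)
        where open ℕ.≤-Reasoning
      ρ : Fin 4 → Fin m₂
      ρ t = inject≤ t 4≤m₂

  good : Good f
  good h iso = cube-automorphism⇒∼ h f iso (all-Kept h iso)

-- The exceptional networks

module BadNetworks {n w a ℓ : ℕ} (2≤w : 2 ≤ w) (room : (4 * w + a) * 2 ≤ n) (n≤ : n ≤ 2 ^ ℓ) where

  module Star = Dense {g = 4 * w} {a = a} (enum-Vec enum-Bool n) room _,_
    (λ u eq → proj₂ (,-injective eq)) (λ _ _ _ → refl)

  module Ladder = Dense {g = 4 * w} {a = a} (enum-× (enum-Vec enum-Bool n) (enum-Fin {k = ℓ} n≤)) room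
    (λ (u , i) j → flipAt u j , i) (λ (u , i) eq → flipAt-index u (proj₁ (,-injective eq)))
    (λ (u , i) j k → trans (parity-flipAt u j) (sym (parity-flipAt u k)))

  module Chord = Sparse {n} {w} {ℓ} n≤

  bad : List (Vec Bool (2 ^ n * n))
  bad = Star.cover ++ Ladder.cover ++ Chord.cover

  good : (f : BN n) → ¬ table f ∈ bad → Good f
  good f f∉ = Rigidity.good 2≤w f
    (Star.many-present f (f∉ ∘ ∈-++⁺ˡ))
    (λ u i → Ladder.many-present f (f∉ ∘ ∈-++⁺ʳ Star.cover ∘ ∈-++⁺ˡ) (u , i))
    (Chord.few-broken f (f∉ ∘ ∈-++⁺ʳ Star.cover ∘ ∈-++⁺ʳ Ladder.cover))

-- Numerical estimates

1+m≤2^m : ∀ m → suc m ≤ 2 ^ m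
1+m≤2^m zero = ℕ.≤-refl
1+m≤2^m (suc m) = ℕ.+-mono-≤ (ℕ.m^n>0 2 m) (ℕ.≤-trans (1+m≤2^m m) (ℕ.m≤m+n (2 ^ m) 0))

length-++³-≤ : {A : Set} (xs ys zs : List A) {c b : ℕ} →
  length xs * c ≤ b → length ys * c ≤ b → length zs * c ≤ b → length (xs ++ ys ++ zs) * c ≤ 3 * b
length-++³-≤ xs ys zs {c} {b} hx hy hz = begin
  length (xs ++ ys ++ zs) * c                        ≡⟨ cong (_* c) (trans (length-++ xs) (cong (length xs +_) (length-++ ys))) ⟩
  (length xs + (length ys + length zs)) * c          ≡⟨ distrib (length xs) (length ys) (length zs) c ⟩
  length xs * c + (length ys * c + (length zs * c + 0)) ≤⟨ ℕ.+-mono-≤ hx (ℕ.+-mono-≤ hy (ℕ.+-monoˡ-≤ 0 hz)) ⟩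
  3 * b                                              ∎
  where
  open ℕ.≤-Reasoning
  distrib : ∀ x y z c → (x + (y + z)) * c ≡ x * c + (y * c + (z * c + 0))
  distrib = solve-∀

-- e is about n / 256; with w = 6e and a = 104e, all three union bounds gain a factor exponential in e.
module Bounds (k n e : ℕ) (big : 1000 + 3 * k ≤ e) (e*256≤n : e * 256 ≤ n) (n≤ : n ≤ 255 + e * 256) where
  open ℕ.≤-Reasoning

  w a ℓ K : ℕ
  w = 6 * e
  a = 104 * e
  -- A crude bound on the logarithm of `n`: `n < 256(e+1)` and `e+1 ≤ 2^e`.
  ℓ = e + 8
  -- `2^K` exceeds `3k`, which pays for the three covers and the factor `k`.
  K = 3 * k

  const≤e : ∀ c → c ≤ 1000 → c + K ≤ e
  const≤e c c≤ = ℕ.≤-trans (ℕ.+-monoˡ-≤ K c≤) big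

  509≤e : 509 ≤ e
  509≤e = ℕ.≤-trans (ℕ.m≤m+n 509 (491 + K)) big

  2≤w : 2 ≤ w
  2≤w = ℕ.≤-trans (ℕ.≤-trans (ℕ.m≤m+n 2 507) 509≤e) (ℕ.m≤m+n e (5 * e))

  room : (4 * w + a) * 2 ≤ n
  room = ℕ.≤-trans (ℕ.≤-reflexive (eq e)) e*256≤n
    where
    eq : ∀ e → (4 * (6 * e) + 104 * e) * 2 ≡ e * 256
    eq = solve-∀

  n≤2^ℓ : n ≤ 2 ^ ℓ
  n≤2^ℓ = begin
    n                ≤⟨ n≤ ⟩
    255 + e * 256    ≤⟨ ℕ.n≤1+n (255 + e * 256) ⟩
    suc e * 256      ≤⟨ ℕ.*-monoˡ-≤ 256 (1+m≤2^m e) ⟩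
    2 ^ e * 2 ^ 8    ≡⟨ ℕ.^-distribˡ-+-* 2 e 8 ⟨
    2 ^ (e + 8)      ∎

  -- In units of `e`, the code costs `256 + 1 + 128 = 385` against `416` fixed bits.
  ladder-bound : (n * 1 + ℓ) + (4 * w + a) * 1 + K ≤ a * 2 * 2
  ladder-bound = begin
    (n * 1 + ℓ) + (4 * w + a) * 1 + K                 ≡⟨ eq₁ n e K ⟩
    n + (129 * e + 8 + K)                             ≤⟨ ℕ.+-monoˡ-≤ (129 * e + 8 + K) n≤ ⟩
    255 + e * 256 + (129 * e + 8 + K)                 ≡⟨ eq₂ e K ⟩
    385 * e + (263 + K)                               ≤⟨ ℕ.+-monoʳ-≤ (385 * e) (const≤e 263 (ℕ.m≤m+n 263 737)) ⟩
    385 * e + e                                       ≤⟨ ℕ.m≤m+n (385 * e + e) (30 * e) ⟩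
    385 * e + e + 30 * e                              ≡⟨ eq₃ e ⟩
    a * 2 * 2                                         ∎
    where
    eq₁ : ∀ n e K → (n * 1 + (e + 8)) + (4 * (6 * e) + 104 * e) * 1 + K ≡ n + (129 * e + 8 + K)
    eq₁ = solve-∀
    eq₂ : ∀ e K → 255 + e * 256 + (129 * e + 8 + K) ≡ 385 * e + (263 + K)
    eq₂ = solve-∀
    eq₃ : ∀ e → 385 * e + e + 30 * e ≡ 104 * e * 2 * 2
    eq₃ = solve-∀

  star-bound : n * 1 + (4 * w + a) * 1 + K ≤ a * 2 * 2
  star-bound = ℕ.≤-trans (ℕ.+-monoˡ-≤ K (ℕ.+-monoˡ-≤ ((4 * w + a) * 1) (ℕ.m≤m+n (n * 1) ℓ))) ladder-bound

  -- In units of `e * e`, the lists `D`, `J` and `B` cost `24 + 6 + 36 = 66` against `72` fixed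
  -- bits; all other terms are linear and are absorbed by `509≤e`.
  chord-bound : (n * 1 + (4 * w * ℓ + (w * ℓ + (w * 2 + w * (w * 1))))) + K ≤ w * w * 2
  chord-bound = begin
    (n * 1 + (4 * w * ℓ + (w * ℓ + (w * 2 + w * (w * 1))))) + K  ≡⟨ eq₁ n e K ⟩
    n + (66 * (e * e) + 252 * e + K)                   ≤⟨ ℕ.+-monoˡ-≤ (66 * (e * e) + 252 * e + K) n≤ ⟩
    255 + e * 256 + (66 * (e * e) + 252 * e + K)       ≡⟨ eq₂ e K ⟩
    66 * (e * e) + 508 * e + (255 + K)                 ≤⟨ ℕ.+-monoʳ-≤ (66 * (e * e) + 508 * e) (const≤e 255 (ℕ.m≤m+n 255 745)) ⟩
    66 * (e * e) + 508 * e + e                         ≡⟨ eq₃ e ⟩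
    66 * (e * e) + 509 * e                             ≤⟨ ℕ.+-monoʳ-≤ (66 * (e * e)) (ℕ.*-monoˡ-≤ e 509≤e) ⟩
    66 * (e * e) + e * e                               ≤⟨ ℕ.m≤m+n (66 * (e * e) + e * e) (5 * (e * e)) ⟩
    66 * (e * e) + e * e + 5 * (e * e)                 ≡⟨ eq₄ e ⟩
    w * w * 2                                          ∎
    where
    eq₁ : ∀ n e K → (n * 1 + (4 * (6 * e) * (e + 8) + (6 * e * (e + 8) + (6 * e * 2 + 6 * e * (6 * e * 1))))) + K
                  ≡ n + (66 * (e * e) + 252 * e + K)
    eq₁ = solve-∀
    eq₂ : ∀ e K → 255 + e * 256 + (66 * (e * e) + 252 * e + K) ≡ 66 * (e * e) + 508 * e + (255 + K)
    eq₂ = solve-∀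
    eq₃ : ∀ e → 66 * (e * e) + 508 * e + e ≡ 66 * (e * e) + 509 * e
    eq₃ = solve-∀
    eq₄ : ∀ e → 66 * (e * e) + e * e + 5 * (e * e) ≡ 6 * e * (6 * e) * 2
    eq₄ = solve-∀

  open BadNetworks {n} {w} {a} {ℓ} 2≤w room n≤2^ℓ public

  bad-length : k * length bad ≤ cardF n
  bad-length = ℕ.*-cancelˡ-≤ 3 (begin
    3 * (k * length bad)       ≡⟨ ℕ.*-assoc 3 k (length bad) ⟨
    3 * k * length bad         ≤⟨ ℕ.*-monoˡ-≤ (length bad) (ℕ.≤-trans (ℕ.n≤1+n K) (1+m≤2^m K)) ⟩
    2 ^ K * length bad         ≡⟨ ℕ.*-comm (2 ^ K) (length bad) ⟩
    length bad * 2 ^ K         ≤⟨ length-++³-≤ Star.cover Ladder.cover Chord.cover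
                                    (Star.cover-length star-bound) (Ladder.cover-length ladder-bound)
                                    (Chord.cover-length chord-bound) ⟩
    3 * 2 ^ (2 ^ n * n)        ≡⟨ cong (λ m → 3 * 2 ^ m) (ℕ.*-comm (2 ^ n) n) ⟩
    3 * 2 ^ (n * 2 ^ n)        ≡⟨ cong (3 *_) (ℕ.^-*-assoc 2 n (2 ^ n)) ⟨
    3 * cardF n                ∎)

-- Membership of the table in `bad` is decidable, so the case distinction is made there and not on
-- `Good`.
¬Good⇒listed : ∀ {n} {bad : List (Vec Bool (2 ^ n * n))} (f : BN n) → (¬ table f ∈ bad → Good f) →
  ¬ Good f → ∃ λ i → f ≗ fromTable (List.lookup bad i)
¬Good⇒listed {bad = bad} f good ¬good with DecMembership._∈?_ (≡-dec Bool._≟_) (table f) bad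
... | yes f∈ = index f∈ , λ x → trans (fromTable-table f x) (cong (λ v → fromTable v x) (lookup-index f∈))
... | no f∉ = contradiction (good f∉) ¬good

-- The limit without fractions: for positive `k`, the networks that are not `Good` eventually make
-- up at most `1/k` of `F(n)`. Repetitions in `L` only increase `m`.
theorem1 : (k : ℕ) → ∃ λ N → (n : ℕ) → N ≤ n →
    ∃ λ m → Σ (Fin m → BN n) λ L →
    (k * m ≤ cardF n) × ((f : BN n) → ¬ Good f → ∃ λ i → f ≗ L i)
-- This makes `n / 256` at least `1000 + 3 * k`, with a wide margin over the constants `509`, `263`
-- and `255` of the estimates.
theorem1 k = (1000 + 3 * k) * 256 , λ n N≤n →
  let division = m≡m%n+[m/n]*n n 256
      open Bounds k n (n / 256)
        (subst (_≤ n / 256) (m*n/n≡m (1000 + 3 * k) 256) (/-monoˡ-≤ 256 N≤n))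
        (ℕ.≤-trans (ℕ.m≤n+m _ (n % 256)) (ℕ.≤-reflexive (sym division)))
        (ℕ.≤-trans (ℕ.≤-reflexive division) (ℕ.+-monoˡ-≤ (n / 256 * 256) (ℕ.≤-pred (m%n<n n 256))))
  in length bad , (λ i → fromTable (List.lookup bad i)) , bad-length , λ f → ¬Good⇒listed f (good f)
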